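{- Let $m$ be a positive integer, let $K$ be an integer with $0\le K\le m-1$, and let $a_1,a_2,a_3$ be non-negative integers. Then $$\begin{aligned}S_m(\{a_1,a_2,a_3\},K)={}&\left(\left\lfloor\frac{a_1+a_2+a_3}{m}\right\rfloor-\left\lfloor\frac{a_1+a_2}{m}\right\rfloor-\left\lfloor\frac{a_2+a_3}{m}\right\rfloor-\left\lfloor\frac{a_1+a_3}{m}\right\rfloor\right.\\&\left.\quad+\left\lfloor\frac{a_1}{m}\right\rfloor+\left\lfloor\frac{a_2}{m}\right\rfloor+\left\lfloor\frac{a_3}{m}\right\rfloor\right)(K+1)\\&+\max\bigl(0,\,((a_1+a_2+a_3)\bmod m)+K-m+1\bigr)\\&-\max\bigl(0,\,((a_1+a_2)\bmod m)+K-m+1\bigr)\\&-\max\bigl(0,\,((a_2+a_3)\bmod m)+K-m+1\bigr)\\&-\max\bigl(0,\,((a_1+a_3)\bmod m)+K-m+1\bigr)\\&+\max\bigl(0,\,(a_1\bmod m)+K-m+1\bigr)\\&+\max\bigl(0,\,(a_2\bmod m)+K-m+1\bigr)\\&+\max\bigl(0,\,(a_3\bmod m)+K-m+1\bigr).\end{aligned}$$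
   Context: For a positive integer $m$ and non-negative integers $a_1,a_2,a_3,K$ (the $a_i$ need not be distinct; $\{a_1,a_2,a_3\}$ is just a list of parameters), define $$\begin{aligned}S_m(\{a_1,a_2,a_3\},K)=\sum_{k=0}^K\Bigl(&\left\lfloor\tfrac{a_1+a_2+a_3+k}{m}\right\rfloor-\left\lfloor\tfrac{a_1+a_2+k}{m}\right\rfloor-\left\lfloor\tfrac{a_2+a_3+k}{m}\right\rfloor-\left\lfloor\tfrac{a_1+a_3+k}{m}\right\rfloor\\&+\left\lfloor\tfrac{a_1+k}{m}\right\rfloor+\left\lfloor\tfrac{a_2+k}{m}\right\rfloor+\left\lfloor\tfrac{a_3+k}{m}\right\rfloor-\left\lfloor\tfrac{k}{m}\right\rfloor\Bigr).\end{aligned}$$ For an integer $a$, $(a \bmod m)$ denotes the minimal non-negative representative of the class of $a$ in $\mathbb{Z}/m$, i.e. the integer in $\{0,\dots,m-1\}$ congruent to $a$ modulo $m$. -}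

module Defs where

open import Data.Nat.Base as ℕ using (ℕ; NonZero)
open import Data.Integer.Base using (ℤ; +_; _+_; _-_)
open import Data.Integer.Properties using (+-0-monoid)
open import Data.Fin.Base using (toℕ)
open import Algebra.Properties.Monoid.Sum +-0-monoid using (sum⁺-syntax)

infix 8 _mod_

-- Natural-number quotient and remainder, embedded in ℤ because the sums
-- below involve genuine (untruncated) subtraction.
⌊_/_⌋ : (n m : ℕ) .{{_ : NonZero m}} → ℤ
⌊ n / m ⌋ = + (n ℕ./ m)

_mod_ : (n m : ℕ) .{{_ : NonZero m}} → ℤ
n mod m = + (n ℕ.% m)

summand : (m : ℕ) .{{_ : NonZero m}} (a₁ a₂ a₃ k : ℕ) → ℤ
summand m a₁ a₂ a₃ k =
    ⌊ a₁ ℕ.+ a₂ ℕ.+ a₃ ℕ.+ k / m ⌋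
  - ⌊ a₁ ℕ.+ a₂ ℕ.+ k / m ⌋ - ⌊ a₂ ℕ.+ a₃ ℕ.+ k / m ⌋ - ⌊ a₁ ℕ.+ a₃ ℕ.+ k / m ⌋
  + ⌊ a₁ ℕ.+ k / m ⌋ + ⌊ a₂ ℕ.+ k / m ⌋ + ⌊ a₃ ℕ.+ k / m ⌋
  - ⌊ k / m ⌋

-- ∑[ k ≤ K ] ranges over k : Fin (suc K), i.e. over k = 0, …, K.
S : (m : ℕ) .{{_ : NonZero m}} (a₁ a₂ a₃ K : ℕ) → ℤ
S m a₁ a₂ a₃ K = ∑[ k ≤ K ] summand m a₁ a₂ a₃ (toℕ k)

{-# OPTIONS --safe #-}
-- For 0 ≤ n ≤ m the function n ↦ ⌊a/m⌋ n + max(0, (a mod m) + n − m) has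
-- increments ⌊(a + n)/m⌋: the floor exceeds ⌊a/m⌋ by one exactly when
-- (a mod m) + n reaches m. The sum therefore telescopes, and the parameter
-- a = 0, which accounts for the term ⌊k/m⌋, contributes nothing.
module Submission where

open import Defs
open import Data.Fin.Base using (toℕ)
open import Data.Fin.Properties using (toℕ<n)
open import Data.Nat.Base as ℕ using (ℕ; zero; suc; NonZero)
import Data.Nat.DivMod as ℕ
import Data.Nat.Divisibility as ℕ
import Data.Nat.Properties as ℕ
import Data.Nat.Tactic.RingSolver as ℕ-Ring
open import Data.Integer.Base using (ℤ; +_; 0ℤ; 1ℤ; _+_; _-_; _*_; _⊔_; _⊖_)
open import Data.Integer.Properties using (+-0-monoid; +-identityʳ; [1+m]⊖[1+n]≡m⊖n; m-n≡m⊖n; pos-*)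
open import Algebra.Properties.Monoid.Sum +-0-monoid using (sum; sum-cong-≗)
import Data.Integer.Tactic.RingSolver as ℤ-Ring
open import Function.Base using (_∘_)
open import Relation.Binary.PropositionalEquality
  using (_≡_; refl; sym; trans; cong; cong₂; module ≡-Reasoning)
open import Relation.Nullary using (yes; no)

open ≡-Reasoning

sum-telescope : (f : ℕ → ℤ) (n : ℕ) →
  sum {n} (λ i → f (suc (toℕ i)) - f (toℕ i)) ≡ f n - f 0
sum-telescope f zero    = lemma (f 0)
  where
  lemma : ∀ x → 0ℤ ≡ x - x
  lemma = ℤ-Ring.solve-∀
sum-telescope f (suc n) = trans
  -- `sum` recurses on its first term, so what remains is the same kind of sum for the shifted
  -- function `f ∘ suc`.
  (cong (λ s → f 1 - f 0 + s) (sum-telescope (f ∘ suc) n))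
  (lemma (f 0) (f 1) (f (suc n)))
  where
  lemma : ∀ x y z → y - x + (z - y) ≡ z - x
  lemma = ℤ-Ring.solve-∀

0⊔-⊖ : ∀ m n → 0ℤ ⊔ (m ⊖ n) ≡ + (m ℕ.∸ n)
0⊔-⊖ m       zero    = refl
0⊔-⊖ zero    (suc n) = refl
0⊔-⊖ (suc m) (suc n) = trans (cong (0ℤ ⊔_) ([1+m]⊖[1+n]≡m⊖n m n)) (0⊔-⊖ m n)

module _ (m : ℕ) .{{_ : NonZero m}} where

  -- Below `2m` the quotient is 0 or 1, and it is 1 exactly when `m ≤ x`, which is also when `x ∸ m`
  -- grows as `x` goes to `suc x`.
  /-+-∸ : ∀ {x} → x ℕ.< m ℕ.+ m → x ℕ./ m ℕ.+ (x ℕ.∸ m) ≡ suc x ℕ.∸ m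
  /-+-∸ {x} x<2m with m ℕ.≤? x
  ... | no m≰x = begin
    x ℕ./ m ℕ.+ (x ℕ.∸ m) ≡⟨ cong₂ ℕ._+_ (ℕ.m<n⇒m/n≡0 x<m) (ℕ.m≤n⇒m∸n≡0 (ℕ.<⇒≤ x<m)) ⟩
    0                     ≡⟨ ℕ.m≤n⇒m∸n≡0 x<m ⟨
    suc x ℕ.∸ m           ∎
    where x<m = ℕ.≰⇒> m≰x
  ... | yes m≤x = begin
    x ℕ./ m ℕ.+ (x ℕ.∸ m)             ≡⟨ cong (ℕ._+ (x ℕ.∸ m)) (ℕ.m/n≡1+[m∸n]/n m≤x) ⟩
    suc ((x ℕ.∸ m) ℕ./ m) ℕ.+ (x ℕ.∸ m) ≡⟨ cong (λ q → suc q ℕ.+ (x ℕ.∸ m)) (ℕ.m<n⇒m/n≡0 x∸m<m) ⟩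
    suc (x ℕ.∸ m)                     ≡⟨ ℕ.+-∸-assoc 1 m≤x ⟨
    suc x ℕ.∸ m                       ∎
    where x∸m<m = ℕ.m<n+o⇒m∸n<o x m x<2m

  /-+ : ∀ a n → (a ℕ.+ n) ℕ./ m ≡ a ℕ./ m ℕ.+ (a ℕ.% m ℕ.+ n) ℕ./ m
  /-+ a n = begin
    (a ℕ.+ n) ℕ./ m
      ≡⟨ cong (λ b → (b ℕ.+ n) ℕ./ m) (ℕ.m≡m%n+[m/n]*n a m) ⟩
    (a ℕ.% m ℕ.+ a ℕ./ m ℕ.* m ℕ.+ n) ℕ./ m
      ≡⟨ cong (ℕ._/ m) (shuffle (a ℕ.% m) (a ℕ./ m ℕ.* m) n) ⟩
    (a ℕ./ m ℕ.* m ℕ.+ (a ℕ.% m ℕ.+ n)) ℕ./ m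
      ≡⟨ ℕ.+-distrib-/-∣ˡ _ (ℕ.n∣m*n (a ℕ./ m)) ⟩
    a ℕ./ m ℕ.* m ℕ./ m ℕ.+ (a ℕ.% m ℕ.+ n) ℕ./ m
      ≡⟨ cong (ℕ._+ (a ℕ.% m ℕ.+ n) ℕ./ m) (ℕ.m*n/n≡m (a ℕ./ m) m) ⟩
    a ℕ./ m ℕ.+ (a ℕ.% m ℕ.+ n) ℕ./ m ∎
    where
    shuffle : ∀ r q n → r ℕ.+ q ℕ.+ n ≡ q ℕ.+ (r ℕ.+ n)
    shuffle = ℕ-Ring.solve-∀

  -- For `n ≤ m` this is a closed form of the sum of `(a + j) / m` over `j < n`. Truncated
  -- subtraction plays the role of the maximum with 0, so the recurrence can be proved in ℕ.
  floorSum : ℕ → ℕ → ℕ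
  floorSum a n = a ℕ./ m ℕ.* n ℕ.+ (a ℕ.% m ℕ.+ n ℕ.∸ m)

  floorSum-suc : ∀ a {n} → n ℕ.< m →
    floorSum a (suc n) ≡ (a ℕ.+ n) ℕ./ m ℕ.+ floorSum a n
  floorSum-suc a {n} n<m = begin
    q ℕ.* suc n ℕ.+ (r ℕ.+ suc n ℕ.∸ m)
      ≡⟨ cong (λ x → q ℕ.* suc n ℕ.+ (x ℕ.∸ m)) (ℕ.+-suc r n) ⟩
    q ℕ.* suc n ℕ.+ (suc (r ℕ.+ n) ℕ.∸ m)
      -- Both `r` and `n` are below `m`, so `r + n` is in the range where the carry is at most 1.
      ≡⟨ cong (q ℕ.* suc n ℕ.+_) (/-+-∸ (ℕ.+-mono-< (ℕ.m%n<n a m) n<m)) ⟨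
    q ℕ.* suc n ℕ.+ ((r ℕ.+ n) ℕ./ m ℕ.+ (r ℕ.+ n ℕ.∸ m))
      ≡⟨ shuffle q n _ _ ⟩
    q ℕ.+ (r ℕ.+ n) ℕ./ m ℕ.+ floorSum a n
      ≡⟨ cong (ℕ._+ floorSum a n) (/-+ a n) ⟨
    (a ℕ.+ n) ℕ./ m ℕ.+ floorSum a n ∎
    where
    q = a ℕ./ m
    r = a ℕ.% m
    shuffle : ∀ q n x y → q ℕ.* suc n ℕ.+ (x ℕ.+ y) ≡ q ℕ.+ x ℕ.+ (q ℕ.* n ℕ.+ y)
    shuffle = ℕ-Ring.solve-∀

  floor-difference : ∀ a {n} → n ℕ.< m →
    ⌊ a ℕ.+ n / m ⌋ ≡ + floorSum a (suc n) - + floorSum a n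
  floor-difference a {n} n<m = trans (lemma _ (+ floorSum a n))
    (cong (λ x → + x - + floorSum a n) (sym (floorSum-suc a n<m)))
    where
    lemma : ∀ x y → x ≡ x + y - y
    lemma = ℤ-Ring.solve-∀

  floorSum-zeroʳ : ∀ a → floorSum a 0 ≡ 0
  floorSum-zeroʳ a = cong₂ ℕ._+_ (ℕ.*-zeroʳ (a ℕ./ m))
    (ℕ.m≤n⇒m∸n≡0 (ℕ.≤-trans (ℕ.≤-reflexive (ℕ.+-identityʳ _)) (ℕ.<⇒≤ (ℕ.m%n<n a m))))

  -- Quotient and remainder of 0 vanish, leaving `n ∸ m`. The bound includes `n = m`, the case
  -- `K = m - 1` with `n = suc K`.
  floorSum-zeroˡ : ∀ {n} → n ℕ.≤ m → floorSum 0 n ≡ 0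
  floorSum-zeroˡ {n} n≤m = cong₂ ℕ._+_ (cong (ℕ._* n) (ℕ.0/n≡0 m))
    (trans (cong (λ r → r ℕ.+ n ℕ.∸ m) (ℕ.m<n⇒m%n≡m (ℕ.>-nonZero⁻¹ m))) (ℕ.m≤n⇒m∸n≡0 n≤m))

  floorSum-⊔ : ∀ a K → + floorSum a (suc K) ≡
    ⌊ a / m ⌋ * (+ K + 1ℤ) + (0ℤ ⊔ (a mod m + + K - + m + 1ℤ))
  floorSum-⊔ a K = cong₂ _+_
    (trans (pos-* (a ℕ./ m) (suc K)) (cong (λ n → ⌊ a / m ⌋ * + n) (ℕ.+-comm 1 K)))
    (begin
      + (r ℕ.+ suc K ℕ.∸ m)            ≡⟨ 0⊔-⊖ (r ℕ.+ suc K) m ⟨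
      0ℤ ⊔ (r ℕ.+ suc K ⊖ m)           ≡⟨ cong (0ℤ ⊔_) (m-n≡m⊖n (r ℕ.+ suc K) m) ⟨
      0ℤ ⊔ (+ r + (1ℤ + + K) - + m)    ≡⟨ cong (0ℤ ⊔_) (shuffle (+ r) (+ K) (+ m)) ⟩
      0ℤ ⊔ (+ r + + K - + m + 1ℤ)      ∎)
    where
    r = a ℕ.% m
    shuffle : ∀ r K m → r + (1ℤ + K) - m ≡ r + K - m + 1ℤ
    shuffle = ℤ-Ring.solve-∀

-- The third finite difference of `f` at 0 with steps `a₁`, `a₂`, `a₃`: a signed sum over the
-- subsets of the parameters, with `f 0` for the empty one.
altSum : (a₁ a₂ a₃ : ℕ) → (ℕ → ℤ) → ℤ
altSum a₁ a₂ a₃ f =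
    f (a₁ ℕ.+ a₂ ℕ.+ a₃) - f (a₁ ℕ.+ a₂) - f (a₂ ℕ.+ a₃) - f (a₁ ℕ.+ a₃)
  + f a₁ + f a₂ + f a₃ - f 0

altSum-cong : ∀ a₁ a₂ a₃ {f g} → (∀ a → f a ≡ g a) → altSum a₁ a₂ a₃ f ≡ altSum a₁ a₂ a₃ g
altSum-cong a₁ a₂ a₃ f≗g
  rewrite f≗g (a₁ ℕ.+ a₂ ℕ.+ a₃) | f≗g (a₁ ℕ.+ a₂) | f≗g (a₂ ℕ.+ a₃) | f≗g (a₁ ℕ.+ a₃)
        | f≗g a₁ | f≗g a₂ | f≗g a₃ | f≗g 0 = refl

-- Linearity in `f` carries the telescoping from each single parameter to the whole combination.
altSum-- : ∀ a₁ a₂ a₃ f g →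
  altSum a₁ a₂ a₃ (λ a → f a - g a) ≡ altSum a₁ a₂ a₃ f - altSum a₁ a₂ a₃ g
altSum-- a₁ a₂ a₃ f g = lemma
  (f (a₁ ℕ.+ a₂ ℕ.+ a₃)) (f (a₁ ℕ.+ a₂)) (f (a₂ ℕ.+ a₃)) (f (a₁ ℕ.+ a₃)) (f a₁) (f a₂) (f a₃) (f 0)
  (g (a₁ ℕ.+ a₂ ℕ.+ a₃)) (g (a₁ ℕ.+ a₂)) (g (a₂ ℕ.+ a₃)) (g (a₁ ℕ.+ a₃)) (g a₁) (g a₂) (g a₃) (g 0)
  where
  lemma : ∀ s t u v w x y z s′ t′ u′ v′ w′ x′ y′ z′ →
    (s - s′) - (t - t′) - (u - u′) - (v - v′) + (w - w′) + (x - x′) + (y - y′) - (z - z′) ≡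
    (s - t - u - v + w + x + y - z) - (s′ - t′ - u′ - v′ + w′ + x′ + y′ - z′)
  lemma = ℤ-Ring.solve-∀

module _ (m : ℕ) .{{_ : NonZero m}} (a₁ a₂ a₃ : ℕ) where

  altFloorSum : ℕ → ℤ
  altFloorSum n = altSum a₁ a₂ a₃ (λ a → + floorSum m a n)

  summand-difference : ∀ {k} → k ℕ.< m →
    summand m a₁ a₂ a₃ k ≡ altFloorSum (suc k) - altFloorSum k
  summand-difference {k} k<m = trans
    -- `summand` is by computation `altSum` of the function `a ↦ ⌊ a + k / m ⌋`; its last term fits
    -- because `0 + k` reduces to `k`.
    (altSum-cong a₁ a₂ a₃ (λ a → floor-difference m a k<m))
    (altSum-- a₁ a₂ a₃ (λ a → + floorSum m a (suc k)) (λ a → + floorSum m a k))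

  S≡altFloorSum : ∀ {K} → K ℕ.< m → S m a₁ a₂ a₃ K ≡ altFloorSum (suc K)
  S≡altFloorSum {K} K<m = begin
    S m a₁ a₂ a₃ K
      ≡⟨ sum-cong-≗ {suc K} (λ k → summand-difference (ℕ.<-≤-trans (toℕ<n k) K<m)) ⟩
    sum {suc K} (λ k → altFloorSum (suc (toℕ k)) - altFloorSum (toℕ k))
      ≡⟨ sum-telescope altFloorSum (suc K) ⟩
    altFloorSum (suc K) - altFloorSum 0
      ≡⟨ cong (λ x → altFloorSum (suc K) - x) (altSum-cong a₁ a₂ a₃ (λ a → cong +_ (floorSum-zeroʳ m a))) ⟩
    altFloorSum (suc K) - 0ℤ
      ≡⟨ +-identityʳ _ ⟩
    altFloorSum (suc K) ∎

proposition11 : (m : ℕ) .{{_ : NonZero m}} (K : ℕ) → K ℕ.≤ m ℕ.∸ 1 →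
    (a₁ a₂ a₃ : ℕ) →
    S m a₁ a₂ a₃ K ≡
    (⌊ a₁ ℕ.+ a₂ ℕ.+ a₃ / m ⌋
    - ⌊ a₁ ℕ.+ a₂ / m ⌋ - ⌊ a₂ ℕ.+ a₃ / m ⌋ - ⌊ a₁ ℕ.+ a₃ / m ⌋
    + ⌊ a₁ / m ⌋ + ⌊ a₂ / m ⌋ + ⌊ a₃ / m ⌋) * (+ K + 1ℤ)
    + (0ℤ ⊔ ((a₁ ℕ.+ a₂ ℕ.+ a₃) mod m + + K - + m + 1ℤ))
    - (0ℤ ⊔ ((a₁ ℕ.+ a₂) mod m + + K - + m + 1ℤ))
    - (0ℤ ⊔ ((a₂ ℕ.+ a₃) mod m + + K - + m + 1ℤ))
    - (0ℤ ⊔ ((a₁ ℕ.+ a₃) mod m + + K - + m + 1ℤ))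
    + (0ℤ ⊔ (a₁ mod m + + K - + m + 1ℤ))
    + (0ℤ ⊔ (a₂ mod m + + K - + m + 1ℤ))
    + (0ℤ ⊔ (a₃ mod m + + K - + m + 1ℤ))
proposition11 m K K≤m-1 a₁ a₂ a₃ = begin
  S m a₁ a₂ a₃ K
    ≡⟨ S≡altFloorSum m a₁ a₂ a₃ K<m ⟩
  altFloorSum m a₁ a₂ a₃ (suc K)
    ≡⟨ altSum-cong a₁ a₂ a₃ (λ a → floorSum-⊔ m a K) ⟩
  altSum a₁ a₂ a₃ g
    -- The term `g 0` of the empty subset is turned back into `floorSum m 0 (suc K)`, which vanishes
    -- since `suc K ≤ m`.
    ≡⟨ cong (λ x → g (a₁ ℕ.+ a₂ ℕ.+ a₃) - g (a₁ ℕ.+ a₂) - g (a₂ ℕ.+ a₃) - g (a₁ ℕ.+ a₃) + g a₁ + g a₂ + g a₃ - x)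
            (trans (sym (floorSum-⊔ m 0 K)) (cong +_ (floorSum-zeroˡ m K<m))) ⟩
  g (a₁ ℕ.+ a₂ ℕ.+ a₃) - g (a₁ ℕ.+ a₂) - g (a₂ ℕ.+ a₃) - g (a₁ ℕ.+ a₃) + g a₁ + g a₂ + g a₃ - 0ℤ
    ≡⟨ collect (+ K + 1ℤ)
         (q (a₁ ℕ.+ a₂ ℕ.+ a₃)) (q (a₁ ℕ.+ a₂)) (q (a₂ ℕ.+ a₃)) (q (a₁ ℕ.+ a₃)) (q a₁) (q a₂) (q a₃)
         (r (a₁ ℕ.+ a₂ ℕ.+ a₃)) (r (a₁ ℕ.+ a₂)) (r (a₂ ℕ.+ a₃)) (r (a₁ ℕ.+ a₃)) (r a₁) (r a₂) (r a₃) ⟩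
  _ ∎
  where
  K<m : K ℕ.< m
  -- Positivity of `m` enters here: for `m = 0` the truncated `m ∸ 1` would still admit `K = 0`.
  K<m = ℕ.m≤pred[n]⇒suc[m]≤n K≤m-1
  q r g : ℕ → ℤ
  q a = ⌊ a / m ⌋
  r a = 0ℤ ⊔ (a mod m + + K - + m + 1ℤ)
  g a = q a * (+ K + 1ℤ) + r a
  collect : ∀ k s t u v x y z s′ t′ u′ v′ x′ y′ z′ →
    (s * k + s′) - (t * k + t′) - (u * k + u′) - (v * k + v′)
      + (x * k + x′) + (y * k + y′) + (z * k + z′) - 0ℤ ≡
    (s - t - u - v + x + y + z) * k + s′ - t′ - u′ - v′ + x′ + y′ + z′
  collect = ℤ-Ring.solve-∀
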